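{- Let $k\ge 1$ and let $g\colon\{0,1\}^k\times\{0,1\}^k\to\{0,1\}$ be a regular function. Then for every $N=2^n$ (with $n\ge 1$), there is a rectangular reduction from $\mathrm{Col}_N\circ g$ to $\mathrm{BiCol}_{N^{2k}}$, i.e. $$\mathrm{Col}_N\circ g\ \le\ \mathrm{BiCol}_{N^{2k}}.$$
   Context: **Collision problem.** For even $N$, $\mathrm{Col}_N\colon[N]^N\to\{0,1,*\}$ is the partial function with $\mathrm{Col}_N(z)=0$ iff $z=(z_1,\dots,z_N)$ is 1-to-1 (every number occurring in the list occurs exactly once), $\mathrm{Col}_N(z)=1$ iff $z$ is 2-to-1 (every number occurring in the list occurs exactly twice), and $\mathrm{Col}_N(z)=*$ otherwise. For $N=2^n$, identify $[N]$ with $\{0,1\}^n$ and view $\mathrm{Col}_N$ as a partial boolean function $(\{0,1\}^n)^N\to\{0,1,*\}$ of $nN$ bits. **Bipartite Collision problem.** For $N'=2^{m}$ with $m$ even, $\mathrm{BiCol}_{N'}\colon(\{0,1\}^{m/2})^{N'}\times(\{0,1\}^{m/2})^{N'}\to\{0,1,*\}$ is defined by $\mathrm{BiCol}_{N'}(x,y):=\mathrm{Col}_{N'}(z)$ where $z_i:=x_iy_i\in\{0,1\}^{m}$ is the concatenation of $x_i$ and $y_i$. (For $N'=N^{2k}=2^{2kn}$ we have $m=2kn$.) **Composition.** For a partial boolean function $f\colon\{0,1\}^\ell\to\{0,1,*\}$ and $g\colon\Sigma\times\Sigma\to\{0,1\}$, the bipartite function $f\circ g\colon\Sigma^\ell\times\Sigma^\ell\to\{0,1,*\}$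 is $(f\circ g)(x,y):=f(g(x_1,y_1),\dots,g(x_\ell,y_\ell))$. For $\mathrm{Col}_N\circ g$ we take $\ell=nN$ and $\Sigma=\{0,1\}^k$. **Rectangular reduction.** For bipartite functions $F$ on $X\times Y$ and $G$ on $X'\times Y'$ (with values in $\{0,1,*\}$), $F\le G$ means that there exist maps $a\colon X\to X'$ and $b\colon Y\to Y'$ such that $F(x,y)=G(a(x),b(y))$ for all $(x,y)\in X\times Y$. **Regular function.** Let $\Pi_m$ be the group of all permutations of an $m$-element set. A subgroup $S\subseteq\Pi_{2^k}\times\Pi_{2^k}$ acts on $\{0,1\}^k\times\{0,1\}^k$ by $s\cdot(x,y):=(s^A(x),s^B(y))$ for $s=(s^A,s^B)\in S$. A function $g\colon\{0,1\}^k\times\{0,1\}^k\to\{0,1\}$ is regular if there is such a group $S$ for which, for each $b\in\{0,1\}$: the orbit $S\cdot(x,y)$ of any $(x,y)\in g^{ -1}(b)$ equals $g^{ -1}(b)$, and, moreover, for every pair $(x_1,y_1),(x_2,y_2)\in g^{ -1}(b)$ there is a unique $s\in S$ with $s\cdot(x_1,y_1)=(x_2,y_2)$. -}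

module Defs where

open import Level using (0ℓ; _⊔_)
open import Algebra.Bundles using (Group)
import Algebra.Construct.DirectProduct as DirectProduct
open import Data.Bool.Base using (Bool; true; false; if_then_else_)
open import Data.Fin.Base using (Fin; zero; combine)
import Data.Fin.Properties as Fin
open import Data.Maybe.Base using (Maybe; just; nothing)
open import Data.Nat.Base using (ℕ; _+_; _*_; _^_)
import Data.Nat.Properties as ℕ
open import Data.Product.Base using (Σ-syntax; ∃; _×_; _,_; proj₁; uncurry)
open import Data.Product using (∃!)
open import Data.Vec.Base using (Vec; []; _∷_; _++_; map; zipWith; count; group)
open import Data.Vec.Relation.Unary.All using (All; all?)
open import Function.Bundles using (_↔_; Inverse)
open import Function.Construct.Composition using (_↔-∘_)
open import Function.Construct.Identity using (↔-id)
open import Function.Construct.Symmetry using (↔-sym)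
open import Relation.Binary.PropositionalEquality.Core
  using (_≡_; refl; sym; trans; cong)
open import Relation.Nullary.Decidable.Core using (Dec; does)
open import Relation.Unary using (Pred; _∈_; _≐_)

Bits : ℕ → Set
Bits = Vec Bool

-- The value set {0, 1, *}: `just false` is 0, `just true` is 1, `nothing` is *.
Value : Set
Value = Maybe Bool

PartialBool : ℕ → Set
PartialBool ℓ = Bits ℓ → Value

Bipartite : Set → Set → Set
Bipartite X Y = X → Y → Value

------------------------------------------------------------------------
-- The collision problem

occurrences : ∀ {N ℓ} → Fin N → Vec (Fin N) ℓ → ℕ
occurrences a z = count (Fin._≟ a) z

_to-1 : ∀ {N ℓ} → ℕ → Vec (Fin N) ℓ → Set
(c to-1) z = All (λ a → occurrences a z ≡ c) z

_to-1? : ∀ {N ℓ} (c : ℕ) (z : Vec (Fin N) ℓ) → Dec ((c to-1) z)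
(c to-1?) z = all? (λ a → occurrences a z ℕ.≟ c) z

-- The two tests exclude each other as soon as N is nonzero.
Col : ∀ N → Vec (Fin N) N → Value
Col N z =
  if does ((1 to-1?) z) then just false
  else if does ((2 to-1?) z) then just true
  else nothing

-- The identification of {0,1}ⁿ with [2ⁿ]: binary, most significant bit first.
number : ∀ {n} → Bits n → Fin (2 ^ n)
number []       = zero
number (b ∷ bs) = combine (Inverse.from Fin.2↔Bool b) (number bs)

-- Col for N = 2ⁿ as a function of N · n bits, read as N blocks of n bits.
ColBits : ∀ n → PartialBool (2 ^ n * n)
ColBits n bits = Col (2 ^ n) (map number (proj₁ (group (2 ^ n) n bits)))

-- Here N′ = 2ᵐ with m = h + h, so that h is m/2.
BiCol : ∀ N′ h → N′ ≡ 2 ^ (h + h) → Bipartite (Vec (Bits h) N′) (Vec (Bits h) N′)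
BiCol .(2 ^ (h + h)) h refl x y = Col (2 ^ (h + h)) (map number (zipWith _++_ x y))

-- N²ᵏ = 2ᵐ for N = 2ⁿ and m/2 = kn.
[2^n]^2k≡2^[kn+kn] : ∀ n k → (2 ^ n) ^ (2 * k) ≡ 2 ^ (k * n + k * n)
[2^n]^2k≡2^[kn+kn] n k = trans (ℕ.^-*-assoc 2 n (2 * k)) (cong (2 ^_)
  (trans (ℕ.*-comm n (2 * k))
  (trans (ℕ.*-assoc 2 k n) (cong (k * n +_) (ℕ.+-identityʳ (k * n))))))

------------------------------------------------------------------------
-- Composition and rectangular reductions

infixr 9 _⊚_
infix  4 _≤ᴿ_

_⊚_ : ∀ {ℓ} {A : Set} → PartialBool ℓ → (A → A → Bool) → Bipartite (Vec A ℓ) (Vec A ℓ)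
(f ⊚ g) x y = f (zipWith g x y)

_≤ᴿ_ : ∀ {X Y X′ Y′} → Bipartite X Y → Bipartite X′ Y′ → Set
_≤ᴿ_ {X} {Y} {X′} {Y′} F G =
  Σ[ a ∈ (X → X′) ] Σ[ b ∈ (Y → Y′) ] (∀ x y → F x y ≡ G (a x) (b y))

------------------------------------------------------------------------
-- Regular functions

-- The symmetric group on A. Permutations are identified when they agree
-- pointwise, and π ∙ ρ applies ρ first.
Π : Set → Group 0ℓ 0ℓ
Π A = record
  { Carrier = A ↔ A
  ; _≈_     = λ π ρ → ∀ x → to π x ≡ to ρ x
  ; _∙_     = λ π ρ → π ↔-∘ ρ
  ; ε       = ↔-id A
  ; _⁻¹     = ↔-sym
  ; isGroup = record
    { isMonoid = record
      { isSemigroup = record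
        { isMagma = record
          { isEquivalence = record
            { refl  = λ _ → refl
            ; sym   = λ p x → sym (p x)
            ; trans = λ p q x → trans (p x) (q x)
            }
          ; ∙-cong = λ {π} {π′} {ρ} {ρ′} p q x →
              trans (cong (to π) (q x)) (p (to ρ′ x))
          }
        ; assoc = λ _ _ _ _ → refl
        }
      ; identity = (λ _ _ → refl) , (λ _ _ → refl)
      }
    ; inverse = (λ π _ → strictlyInverseʳ π _) , (λ π _ → strictlyInverseˡ π _)
    ; ⁻¹-cong = λ {π} {ρ} p x → trans
        (cong (from π) (trans (sym (strictlyInverseˡ ρ x)) (sym (p (from ρ x)))))
        (strictlyInverseʳ π (from ρ x))
    }
  }
  where open Inverse

record IsSubgroup {c ℓ p} (G : Group c ℓ) (S : Pred (Group.Carrier G) p)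
                  : Set (c ⊔ ℓ ⊔ p) where
  open Group G
  field
    resp      : ∀ {s t} → s ≈ t → s ∈ S → t ∈ S
    ε-closed  : ε ∈ S
    ∙-closed  : ∀ {s t} → s ∈ S → t ∈ S → s ∙ t ∈ S
    ⁻¹-closed : ∀ {s} → s ∈ S → s ⁻¹ ∈ S

-- Π_{2ᵏ} × Π_{2ᵏ}, with {0,1}ᵏ as the set of 2ᵏ elements.
Π×Π : ℕ → Group 0ℓ 0ℓ
Π×Π k = DirectProduct.group (Π (Bits k)) (Π (Bits k))

module _ {k : ℕ} where

  open Group (Π×Π k) using (Carrier; _≈_)

  infixr 8 _·_

  _·_ : Carrier → Bits k × Bits k → Bits k × Bits k
  (sᴬ , sᴮ) · (x , y) = Inverse.to sᴬ x , Inverse.to sᴮ y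

  Orbit : Pred Carrier 0ℓ → Bits k × Bits k → Pred (Bits k × Bits k) 0ℓ
  Orbit S p q = ∃ λ s → s ∈ S × s · p ≡ q

  Fibre : (Bits k → Bits k → Bool) → Bool → Pred (Bits k × Bits k) 0ℓ
  Fibre g b p = uncurry g p ≡ b

  record Regular (g : Bits k → Bits k → Bool) : Set₁ where
    field
      S          : Pred Carrier 0ℓ
      isSubgroup : IsSubgroup (Π×Π k) S
      orbit      : ∀ b {p} → p ∈ Fibre g b → Orbit S p ≐ Fibre g b
      unique     : ∀ b {p q} → p ∈ Fibre g b → q ∈ Fibre g b →
                   ∃! _≈_ λ s → s ∈ S × s · p ≡ q

{-# OPTIONS --safe #-}

-- Fix basepoints p₀, p₁ with g p_b = b. For j ∈ {0,1}ᵏ × {0,1}ᵏ let s_j be the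
-- element of S carrying p_{g j} to j. Then, for b fixed, j ↦ s_j enumerates S
-- without repetition as j runs through the fibre of b, hence for every p the
-- points s_j · p run through the fibre of g p, each once. An index of the
-- BiCol instance is a word of n such j: the bits g j spell the index i of an
-- entry of the Col instance, and the entry stored there applies the maps s_j to
-- the n gadget inputs encoding z_i. So z_i is replaced by the list of all
-- its encodings, and multiplicities do not change. If g is constant then S has
-- the wrong size, but one may write all pairs with first bit 0 instead.
module Submission where

open import Defs
open import Data.Bool.Base using (Bool; true; false; if_then_else_)
import Data.Bool.Properties as Bool
open import Data.Empty using (⊥; ⊥-elim)
open import Data.Fin.Base
  using (Fin; zero; suc; combine; quotient; remainder)
import Data.Fin.Properties as Fin
open import Data.Maybe.Base using (just; nothing)
open import Data.Nat.Base using (ℕ; zero; suc; _+_; _*_; _^_; _≤_)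
import Data.Nat.Properties as ℕ
open import Data.Product.Base using (∃; _×_; _,_; proj₁; proj₂; uncurry)
open import Data.Vec.Base
  using (Vec; []; _∷_; _++_; map; zipWith; count; group; lookup; tabulate; take; drop)
import Data.Vec.Properties as Vec
import Data.Vec.Relation.Unary.All.Properties as All
open import Function.Base using (_∘_)
open import Function.Bundles using (Inverse; mk⇔)
open import Relation.Binary.PropositionalEquality
  using (_≡_; refl; sym; trans; cong; cong₂; subst; _≗_)
open import Relation.Nullary.Decidable using (Dec; yes; no; does; does-⇔)
open import Relation.Unary using (Pred; Decidable; _∈_)

-- Comparing counts by injections.

module _ {a p} {A : Set a} {P : Pred A p} (P? : Decidable P) where

  -- `select` turns a number below the count into a position where `P` holds, and `rank` goes back;
  -- with both injective, an inequality of counts reduces to an injection between positions.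
  select : ∀ {n} (xs : Vec A n) → Fin (count P? xs) → Fin n
  select (x ∷ xs) c with P? x
  select (x ∷ xs) zero    | yes _ = zero
  select (x ∷ xs) (suc c) | yes _ = suc (select xs c)
  ...                     | no  _ = suc (select xs c)

  select-satisfies : ∀ {n} (xs : Vec A n) c → P (lookup xs (select xs c))
  select-satisfies (x ∷ xs) c with P? x
  select-satisfies (x ∷ xs) zero    | yes px = px
  select-satisfies (x ∷ xs) (suc c) | yes _  = select-satisfies xs c
  ...                               | no  _  = select-satisfies xs c

  select-injective : ∀ {n} (xs : Vec A n) {c d} → select xs c ≡ select xs d → c ≡ d
  select-injective (x ∷ xs) {c} {d} eq with P? x
  select-injective (x ∷ xs) {zero}  {zero}  eq | yes _ = refl
  select-injective (x ∷ xs) {suc _} {suc _} eq | yes _ =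
    cong suc (select-injective xs (Fin.suc-injective eq))
  ... | no _ = select-injective xs (Fin.suc-injective eq)

  rank : ∀ {n} (xs : Vec A n) i → P (lookup xs i) → Fin (count P? xs)
  rank (x ∷ xs) i p with P? x
  rank (x ∷ xs) zero    p | yes _  = zero
  rank (x ∷ xs) (suc i) p | yes _  = suc (rank xs i p)
  rank (x ∷ xs) zero    p | no ¬px = ⊥-elim (¬px p)
  rank (x ∷ xs) (suc i) p | no _   = rank xs i p

  rank-injective : ∀ {n} (xs : Vec A n) {i j} p q → rank xs i p ≡ rank xs j q → i ≡ j
  rank-injective (x ∷ xs) {i} {j} p q eq with P? x
  rank-injective (x ∷ xs) {zero}  {zero}  p q eq | yes _ = refl
  rank-injective (x ∷ xs) {suc i} {suc j} p q eq | yes _ =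
    cong suc (rank-injective xs p q (Fin.suc-injective eq))
  rank-injective (x ∷ xs) {zero}          p q eq | no ¬px = ⊥-elim (¬px p)
  rank-injective (x ∷ xs) {suc i} {zero}  p q eq | no ¬px = ⊥-elim (¬px q)
  rank-injective (x ∷ xs) {suc i} {suc j} p q eq | no _   = cong suc (rank-injective xs p q eq)

-- The composite of `select`, `f` and `rank` is an injection between the two finite sets. As `f`
-- receives the proof of `P`, it has to be defined only where `P` holds.
count-≤ : ∀ {a b p q} {A : Set a} {B : Set b} {P : Pred A p} {Q : Pred B q}
          (P? : Decidable P) (Q? : Decidable Q) {m n} (xs : Vec A m) (ys : Vec B n)
          (f : ∀ i → P (lookup xs i) → Fin n) →
          (∀ i pi → Q (lookup ys (f i pi))) →
          (∀ i pi j pj → f i pi ≡ f j pj → i ≡ j) →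
          count P? xs ≤ count Q? ys
count-≤ P? Q? xs ys f f-sat f-inj = Fin.injective⇒≤ {f = g} λ {c} {d} eq →
  select-injective P? xs
    (f-inj _ _ _ _ (rank-injective Q? ys (f-sat _ _) (f-sat _ _) eq))
  where
  g : Fin (count P? xs) → Fin (count Q? ys)
  g c = rank Q? ys _ (f-sat (select P? xs c) (select-satisfies P? xs c))

-- Invariance of `Col` under reindexing.

module _ {N M : ℕ} (z : Vec (Fin N) N) (z′ : Vec (Fin M) M) (π : Fin M → Fin N)
         (π-surjective : ∀ i → ∃ λ j → π j ≡ i)
         (π-preserves : ∀ j j′ → lookup z′ j ≡ lookup z′ j′ → lookup z (π j) ≡ lookup z (π j′))
         (π-separates : ∀ j j′ → π j ≡ π j′ → lookup z′ j ≡ lookup z′ j′ → j ≡ j′)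
         (π-lifts : ∀ i j → lookup z i ≡ lookup z (π j) →
                    ∃ λ j′ → π j′ ≡ i × lookup z′ j′ ≡ lookup z′ j)
         where

  -- `π` restricts to a bijection between the positions of `z′` that share the value at `j` and
  -- those of `z` that share the value at `π j`: it lands there by `π-preserves`, is injective by
  -- `π-separates` and onto by `π-lifts`.
  occurrences-reindex : ∀ j → occurrences (lookup z (π j)) z ≡ occurrences (lookup z′ j) z′
  occurrences-reindex j = ℕ.≤-antisym
    (count-≤ _ _ z z′
      (λ i e → proj₁ (π-lifts i j e))
      (λ i e → proj₂ (proj₂ (π-lifts i j e)))
      -- Distinct positions have distinct lifts, because `π` undoes lifting.
      (λ i e i′ e′ eq → trans (sym (proj₁ (proj₂ (π-lifts i j e))))
        (trans (cong π eq) (proj₁ (proj₂ (π-lifts i′ j e′))))))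
    (count-≤ _ _ z′ z
      (λ j′ _ → π j′)
      (λ j′ e → π-preserves j′ j e)
      (λ j₁ e₁ j₂ e₂ eq → π-separates j₁ j₂ eq (trans e₁ (sym e₂))))

  to-1-reindex : ∀ c → does ((c to-1?) z) ≡ does ((c to-1?) z′)
  to-1-reindex c = does-⇔ (mk⇔ to from) ((c to-1?) z) ((c to-1?) z′)
    where
    to : (c to-1) z → (c to-1) z′
    to all = All.lookup⁻ λ j →
      trans (sym (occurrences-reindex j)) (All.lookup⁺ all (π j))

    from : (c to-1) z′ → (c to-1) z
    from all = All.lookup⁻ λ i → let j , πj≡i = π-surjective i in
      subst (λ i → occurrences (lookup z i) z ≡ c) πj≡i
        (trans (occurrences-reindex j) (All.lookup⁺ all j))

  Col-reindex : Col N z ≡ Col M z′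
  Col-reindex = cong₂
    (λ p q → if p then just false else if q then just true else nothing)
    (to-1-reindex 1) (to-1-reindex 2)

-- Binary digits and the packing of words.

digits : ∀ m → Fin (2 ^ m) → Bits m
digits zero    _ = []
digits (suc m) i =
  Inverse.to Fin.2↔Bool (quotient {2} (2 ^ m) i) ∷ digits m (remainder {2} (2 ^ m) i)

digits-number : ∀ {m} (bs : Bits m) → digits m (number bs) ≡ bs
digits-number []               = refl
digits-number {suc m} (b ∷ bs) = cong₂ _∷_
  (trans (cong (Inverse.to Fin.2↔Bool ∘ proj₁) rq) (Inverse.strictlyInverseˡ Fin.2↔Bool b))
  (trans (cong (digits m ∘ proj₂) rq) (digits-number bs))
  where rq = Fin.remQuot-combine (Inverse.from Fin.2↔Bool b) (number bs)

number-digits : ∀ m i → number (digits m i) ≡ i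
number-digits zero    zero = refl
number-digits (suc m) i = trans
  (cong₂ combine (Inverse.strictlyInverseʳ Fin.2↔Bool (quotient {2} (2 ^ m) i))
                 (number-digits m (remainder {2} (2 ^ m) i)))
  (Fin.combine-remQuot {2} (2 ^ m) i)

number-tabulate-injective : ∀ {m} (f f′ : Fin m → Bool) →
                            number (tabulate f) ≡ number (tabulate f′) → f ≗ f′
number-tabulate-injective f f′ eq l = trans (sym (lookup-digits f))
  (trans (cong (λ i → lookup (digits _ i) l) eq) (lookup-digits f′))
  where
  lookup-digits : ∀ f → lookup (digits _ (number (tabulate f))) l ≡ f l
  lookup-digits f =
    trans (cong (λ v → lookup v l) (digits-number (tabulate f))) (Vec.lookup∘tabulate f l)

lookup-injective : ∀ {a} {A : Set a} {n} (xs ys : Vec A n) → lookup xs ≗ lookup ys → xs ≡ ys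
lookup-injective xs ys eq =
  trans (sym (Vec.tabulate∘lookup xs)) (trans (Vec.tabulate-cong eq) (Vec.tabulate∘lookup ys))

lookup-group : ∀ {a} {A : Set a} n k (xs : Vec A (n * k)) i j →
               lookup (lookup (proj₁ (group n k xs)) i) j ≡ lookup xs (combine i j)
lookup-group n k xs i j = let xss , eq = group n k xs in
  trans (sym (Vec.lookup-concat xss i j)) (cong (λ v → lookup v (combine i j)) (sym eq))

module Blocks (k n : ℕ) where

  -- The length `k * n` is read as k rows of n bits with the l-th word as the l-th column, so the
  -- words are interleaved.
  pack : (Fin n → Bits k) → Bits (k * n)
  pack f = tabulate λ c → lookup (f (remainder {k} n c)) (quotient {k} n c)

  unpack : Bits (k * n) → Fin n → Bits k
  unpack bs l = tabulate λ r → lookup bs (combine r l)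

  pack-cong : ∀ {f f′} → f ≗ f′ → pack f ≡ pack f′
  pack-cong eq = Vec.tabulate-cong λ c → cong (λ v → lookup v (quotient {k} n c)) (eq _)

  unpack-pack : ∀ f → unpack (pack f) ≗ f
  unpack-pack f l = trans
    (Vec.tabulate-cong λ r → trans (Vec.lookup∘tabulate _ (combine r l))
      (cong (λ (q , s) → lookup (f s) q) (Fin.remQuot-combine r l)))
    (Vec.tabulate∘lookup (f l))

  pack-unpack : ∀ bs → pack (unpack bs) ≡ bs
  pack-unpack bs = trans
    (Vec.tabulate-cong λ c → trans (Vec.lookup∘tabulate _ (quotient {k} n c))
      (cong (lookup bs) (Fin.combine-remQuot {k} n c)))
    (Vec.tabulate∘lookup bs)

  -- First components fill the first half and second components the second, so each player can
  -- produce one half alone. The same code serves for the indices and for the entries of the `BiCol`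
  -- instance.
  encode : (Fin n → Bits k × Bits k) → Fin (2 ^ (k * n + k * n))
  encode w = number (pack (proj₁ ∘ w) ++ pack (proj₂ ∘ w))

  decode : Fin (2 ^ (k * n + k * n)) → Fin n → Bits k × Bits k
  decode j l =
    unpack (take (k * n) (digits _ j)) l , unpack (drop (k * n) (digits _ j)) l

  encode-cong : ∀ {w w′} → w ≗ w′ → encode w ≡ encode w′
  encode-cong eq =
    cong number (cong₂ _++_ (pack-cong (cong proj₁ ∘ eq)) (pack-cong (cong proj₂ ∘ eq)))

  decode-encode : ∀ w → decode (encode w) ≗ w
  decode-encode w l = trans
    (cong (λ bs → unpack (take (k * n) bs) l , unpack (drop (k * n) bs) l)
          (digits-number (xs ++ ys)))
    (cong₂ _,_
      -- `take` and `drop` rebuild `xs ++ ys`; the prefixes have equal length, so both halves can be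
      -- cancelled.
      (trans (cong (λ bs → unpack bs l) (Vec.++-injectiveˡ (take (k * n) (xs ++ ys)) xs split))
             (unpack-pack (proj₁ ∘ w) l))
      (trans (cong (λ bs → unpack bs l) (Vec.++-injectiveʳ (take (k * n) (xs ++ ys)) xs split))
             (unpack-pack (proj₂ ∘ w) l)))
    where
    xs    = pack (proj₁ ∘ w)
    ys    = pack (proj₂ ∘ w)
    split = Vec.take++drop≡id (k * n) (xs ++ ys)

  encode-decode : ∀ j → encode (decode j) ≡ j
  encode-decode j = trans
    (cong number (trans (cong₂ _++_ (pack-unpack (take (k * n) bs)) (pack-unpack (drop (k * n) bs)))
                        (Vec.take++drop≡id (k * n) bs)))
    (number-digits (k * n + k * n) j)
    where bs = digits (k * n + k * n) j

  encode-injective : ∀ {w w′} → encode w ≡ encode w′ → w ≗ w′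
  encode-injective {w} {w′} eq l = trans (sym (decode-encode w l))
    (trans (cong (λ j → decode j l) eq) (decode-encode w′ l))

  decode-injective : ∀ {j j′} → decode j ≗ decode j′ → j ≡ j′
  decode-injective {j} {j′} eq =
    trans (sym (encode-decode j)) (trans (encode-cong eq) (encode-decode j′))

-- Rerandomisations and the reduction they yield.

-- The points j ▹ p with bit j ≡ b are pairwise distinct and form a set that does
-- not depend on b; it is the same for p and q when g p ≡ g q, disjoint otherwise.
record Rerandomisation {A : Set} (g : A → A → Bool) : Set where
  field
    bit  : A × A → Bool
    move : A × A → (A → A) × (A → A)

  _▹_ : A × A → A × A → A × A
  j ▹ (x , y) = proj₁ (move j) x , proj₂ (move j) y

  field
    preserves : ∀ {j j′ p q} → j ▹ p ≡ j′ ▹ q → uncurry g p ≡ uncurry g q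
    separates : ∀ {j j′ p} → bit j ≡ bit j′ → j ▹ p ≡ j′ ▹ p → j ≡ j′
    lifts     : ∀ b j {p q} → uncurry g q ≡ uncurry g p →
                ∃ λ j′ → bit j′ ≡ b × j′ ▹ q ≡ j ▹ p

module _ {k : ℕ} {g : Bits k → Bits k → Bool} (R : Rerandomisation g) (n : ℕ) where

  open Rerandomisation R
  open Blocks k n

  private
    N = 2 ^ n
    M = 2 ^ (k * n + k * n)

  index : Fin M → Fin N
  index j = number (tabulate (bit ∘ decode j))

  -- `index j` depends on `j` alone, so both players look up the same gadget inputs and each moves
  -- only the share held; this makes the reduction rectangular.
  leftEntry rightEntry : Vec (Bits k) (N * n) → Fin M → Bits (k * n)
  leftEntry  x j = pack λ l → proj₁ (move (decode j l)) (lookup x (combine (index j) l))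
  rightEntry y j = pack λ l → proj₂ (move (decode j l)) (lookup y (combine (index j) l))

  left right : Vec (Bits k) (N * n) → Vec (Bits (k * n)) M
  left  x = tabulate (leftEntry x)
  right y = tabulate (rightEntry y)

  index-bits : ∀ {j i} → (∀ l → bit (decode j l) ≡ lookup (digits n i) l) → index j ≡ i
  index-bits {i = i} eq = trans
    (cong number (trans (Vec.tabulate-cong eq) (Vec.tabulate∘lookup (digits n i))))
    (number-digits n i)

  index-injective : ∀ j j′ → index j ≡ index j′ → bit ∘ decode j ≗ bit ∘ decode j′
  index-injective j j′ = number-tabulate-injective (bit ∘ decode j) (bit ∘ decode j′)

  module _ (x y : Vec (Bits k) (N * n)) where

    rows : Vec (Bits n) N
    rows = proj₁ (group N n (zipWith g x y))

    z : Vec (Fin N) N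
    z = map number rows

    z′ : Vec (Fin M) M
    z′ = map number (zipWith _++_ (left x) (right y))

    input : Fin N → Fin n → Bits k × Bits k
    input i l = lookup x (combine i l) , lookup y (combine i l)

    entry : Fin M → Fin n → Bits k × Bits k
    entry j l = decode j l ▹ input (index j) l

    encoded : Fin N → Fin n → Bool
    encoded i l = uncurry g (input i l)

    lookup-z : ∀ i → lookup z i ≡ number (tabulate (encoded i))
    lookup-z i = trans (Vec.lookup-map i number rows)
      (cong number (lookup-injective (lookup rows i) (tabulate (encoded i)) λ l →
        trans (lookup-group N n (zipWith g x y) i l)
        (trans (Vec.lookup-zipWith g (combine i l) x y)
               (sym (Vec.lookup∘tabulate (encoded i) l)))))

    lookup-z′ : ∀ j → lookup z′ j ≡ encode (entry j)
    lookup-z′ j = trans (Vec.lookup-map j number (zipWith _++_ (left x) (right y)))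
      (cong number (trans (Vec.lookup-zipWith _++_ j (left x) (right y))
        (cong₂ _++_ (Vec.lookup∘tabulate (leftEntry x) j) (Vec.lookup∘tabulate (rightEntry y) j))))

    z-cong : ∀ i i′ → encoded i ≗ encoded i′ → lookup z i ≡ lookup z i′
    z-cong i i′ eq = trans (lookup-z i)
      (trans (cong number (Vec.tabulate-cong eq)) (sym (lookup-z i′)))

    z-injective : ∀ i i′ → lookup z i ≡ lookup z i′ → encoded i ≗ encoded i′
    z-injective i i′ eq = number-tabulate-injective (encoded i) (encoded i′)
      (trans (sym (lookup-z i)) (trans eq (lookup-z i′)))

    z′-injective : ∀ j j′ → lookup z′ j ≡ lookup z′ j′ → entry j ≗ entry j′
    z′-injective j j′ eq = encode-injective {entry j} {entry j′}
      (trans (sym (lookup-z′ j)) (trans eq (lookup-z′ j′)))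

    -- Equal indices give equal bits and the same gadget inputs, so `separates` applies in each
    -- coordinate.
    index-separates : ∀ j j′ → index j ≡ index j′ → lookup z′ j ≡ lookup z′ j′ → j ≡ j′
    index-separates j j′ ieq zeq = decode-injective {j} {j′} λ l →
      separates (index-injective j j′ ieq l)
        (trans (z′-injective j j′ zeq l) (cong (λ i → decode j′ l ▹ input i l) (sym ieq)))

    -- The gadget inputs at `i` and at `index j` have equal values under `g`, so `lifts` applies in
    -- each coordinate, with the digits of `i` as prescribed bits.
    index-lifts : ∀ i j → lookup z i ≡ lookup z (index j) →
                  ∃ λ j′ → index j′ ≡ i × lookup z′ j′ ≡ lookup z′ j
    index-lifts i j eq = j′ , index≡i ,
      trans (lookup-z′ j′) (trans (encode-cong {entry j′} {entry j} entry≗) (sym (lookup-z′ j)))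
      where
      lift : ∀ l → ∃ λ w → bit w ≡ lookup (digits n i) l × w ▹ input i l ≡ entry j l
      lift l = lifts (lookup (digits n i) l) (decode j l) (z-injective i (index j) eq l)

      j′ : Fin M
      j′ = encode (proj₁ ∘ lift)

      index≡i : index j′ ≡ i
      index≡i = index-bits λ l →
        trans (cong bit (decode-encode (proj₁ ∘ lift) l)) (proj₁ (proj₂ (lift l)))

      entry≗ : entry j′ ≗ entry j
      -- `entry j′` reads the input at `index j′`, hence the rewriting along `index≡i`.
      entry≗ l = trans
        (cong₂ _▹_ (decode-encode (proj₁ ∘ lift) l) (cong (λ i → input i l) index≡i))
        (proj₂ (proj₂ (lift l)))

    index-surjective : ∀ i → ∃ λ j → index j ≡ i
    index-surjective i = encode (proj₁ ∘ lift) , index-bits λ l →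
        trans (cong bit (decode-encode (proj₁ ∘ lift) l)) (proj₁ (proj₂ (lift l)))
      where
      lift : ∀ l → ∃ λ w → bit w ≡ lookup (digits n i) l × w ▹ input i l ≡ input i l ▹ input i l
      -- Any pair could start the lift; the input is one at hand.
      lift l = lifts (lookup (digits n i) l) (input i l) refl

    ColBits≡BiCol : ColBits n (zipWith g x y) ≡ BiCol M (k * n) refl (left x) (right y)
    ColBits≡BiCol = Col-reindex z z′ index index-surjective
      (λ j j′ eq → z-cong (index j) (index j′) λ l → preserves (z′-injective j j′ eq l)) index-separates index-lifts

  -- With `N′` a variable the equation can be matched with `refl`, which is impossible for the
  -- concrete power in the theorem.
  rerandomise : ∀ {N′} (eq : N′ ≡ M) → ColBits n ⊚ g ≤ᴿ BiCol N′ (k * n) eq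
  rerandomise refl = left , right , ColBits≡BiCol

-- Rerandomisations of constant and of nonconstant gadgets.

-- The first bit of the left word, present as `1 ≤ k`, takes the role of `g`. The moves ignore the
-- input and overwrite this bit, so either value of it leads to the same points, each once.
constant⇒rerandomisation : ∀ {k} → 1 ≤ k → (g : Bits k → Bits k → Bool) →
                           (∀ p q → uncurry g p ≡ uncurry g q) → Rerandomisation g
constant⇒rerandomisation {suc k} _ g const = record
  { bit       = bit
  ; move      = move
  ; preserves = λ _ → const _ _
  ; separates = separates _ _
  ; lifts     = lifts
  }
  where
  A = Bits (suc k)

  bit : A × A → Bool
  bit (b ∷ _ , _) = b

  move : A × A → (A → A) × (A → A)
  move (_ ∷ xs , y) = (λ _ → false ∷ xs) , (λ _ → y)

  _▹_ : A × A → A × A → A × A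
  j ▹ (x , y) = proj₁ (move j) x , proj₂ (move j) y

  separates : ∀ j j′ {p} → bit j ≡ bit j′ → j ▹ p ≡ j′ ▹ p → j ≡ j′
  separates (_ ∷ _ , _) (_ ∷ _ , _) refl refl = refl

  lifts : ∀ b j {p q} → uncurry g q ≡ uncurry g p → ∃ λ j′ → bit j′ ≡ b × j′ ▹ q ≡ j ▹ p
  lifts b (_ ∷ xs , y) _ = (b ∷ xs , y) , refl , refl

module _ {k : ℕ} {g : Bits k → Bits k → Bool} (regular : Regular g)
         (basepoint : Bool → Bits k × Bits k)
         (basepoint-fibre : ∀ b → uncurry g (basepoint b) ≡ b) where

  open Regular regular

  private
    S-preserves : ∀ {s} → s ∈ S → ∀ p → uncurry g (s · p) ≡ uncurry g p
    S-preserves {s} s∈S p = proj₁ (orbit (uncurry g p) refl) (s , s∈S , refl)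

    -- Both `s` and `t` carry `p` to `t · p`, which lies in the fibre of `p`, so both agree with the
    -- unique such element.
    S-free : ∀ {s t p} → s ∈ S → t ∈ S → s · p ≡ t · p → ∀ q → s · q ≡ t · q
    S-free {s} {t} {p} s∈S t∈S eq (x , y)
      with u , _ , uniq ← unique (uncurry g p) {q = t · p} refl (S-preserves t∈S p)
      with us ← uniq {s} (s∈S , eq) | ut ← uniq {t} (t∈S , refl)
      = cong₂ _,_ (trans (sym (proj₁ us x)) (proj₁ ut x)) (trans (sym (proj₂ us y)) (proj₂ ut y))

    translation : ∀ p q → uncurry g q ≡ uncurry g p → ∃ λ s → s ∈ S × s · p ≡ q
    translation p q eq with s , s-works , _ ← unique (uncurry g p) {p} {q} refl eq = s , s-works

    base : Bits k × Bits k → Bits k × Bits k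
    base j = basepoint (uncurry g j)

    from-base : ∀ j → ∃ λ s → s ∈ S × s · base j ≡ j
    from-base j = translation (base j) j (sym (basepoint-fibre _))

  basepoints⇒rerandomisation : Rerandomisation g
  basepoints⇒rerandomisation = record
    { bit       = uncurry g
    ; move      = λ j → let sᴬ , sᴮ = proj₁ (from-base j) in Inverse.to sᴬ , Inverse.to sᴮ
    ; preserves = λ {j} {j′} {p} {q} eq → trans (sym (S-preserves (s∈S j) p))
        (trans (cong (uncurry g) eq) (S-preserves (s∈S j′) q))
    -- Maps that agree at `p` agree at `base j`, which is also `base j′` as the bits are equal; the
    -- images there are `j` and `j′`.
    ; separates = λ {j} {j′} {p} beq eq → trans (sym (s-base j))
        (trans (S-free {p = p} (s∈S j) (s∈S j′) eq (base j))
        (trans (cong (λ b → proj₁ (from-base j′) · basepoint b) beq) (s-base j′)))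
    ; lifts     = lifts
    }
    where
    s∈S : ∀ j → proj₁ (from-base j) ∈ S
    s∈S j = proj₁ (proj₂ (from-base j))

    s-base : ∀ j → proj₁ (from-base j) · base j ≡ j
    s-base j = proj₂ (proj₂ (from-base j))

    lifts : ∀ b j {p q} → uncurry g q ≡ uncurry g p →
            ∃ λ j′ → uncurry g j′ ≡ b × proj₁ (from-base j′) · q ≡ proj₁ (from-base j) · p
    lifts b j {p} {q} eq
      with t , t∈S , tq ← translation q (proj₁ (from-base j) · p)
                            (trans (S-preserves (s∈S j) p) (sym eq))
      = j′ , gj′ , trans (S-free {p = base j′} (s∈S j′) t∈S j′-agrees q) tq
      where
      -- The map attached to a label is determined by its value at the basepoint, so this label is
      -- the one in the fibre of `b` whose map is `t`.
      j′ = t · basepoint b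

      gj′ : uncurry g j′ ≡ b
      gj′ = trans (S-preserves t∈S (basepoint b)) (basepoint-fibre b)

      j′-agrees : proj₁ (from-base j′) · base j′ ≡ t · base j′
      j′-agrees = trans (s-base j′) (cong (λ b → t · basepoint b) (sym gj′))

-- The case distinction and the theorem.

-- Words are searched through their numbers, which reduces the question to finite search;
-- `digits-number` ensures that no word is missed.
attained? : ∀ {k} (g : Bits k → Bits k → Bool) b → Dec (∃ λ p → uncurry g p ≡ b)
attained? {k} g b
  with Fin.any? (λ i → Fin.any? λ j → g (digits k i) (digits k j) Bool.≟ b)
... | yes (i , j , eq) = yes ((digits k i , digits k j) , eq)
... | no ¬attained     = no λ where
  ((x , y) , eq) → ¬attained (number x , number y ,
    trans (cong₂ g (digits-number x) (digits-number y)) eq)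

missed⇒constant : ∀ {A : Set} (f : A → Bool) {b} → (∀ p → f p ≡ b → ⊥) → ∀ p q → f p ≡ f q
missed⇒constant f missed p q =
  trans (Bool.¬-not (missed p)) (sym (Bool.¬-not (missed q)))

regular⇒rerandomisation : ∀ {k} → 1 ≤ k → (g : Bits k → Bits k → Bool) →
                          Regular g → Rerandomisation g
regular⇒rerandomisation 1≤k g regular with attained? g false | attained? g true
... | no ¬p₀ | _ =
  constant⇒rerandomisation 1≤k g (missed⇒constant (uncurry g) λ p eq → ¬p₀ (p , eq))
... | yes _ | no ¬p₁ =
  constant⇒rerandomisation 1≤k g (missed⇒constant (uncurry g) λ p eq → ¬p₁ (p , eq))
... | yes (p₀ , eq₀) | yes (p₁ , eq₁) = basepoints⇒rerandomisation regular
  (λ b → if b then p₁ else p₀) (λ where false → eq₀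
                                        true  → eq₁)

theorem8 : ∀ (k : ℕ) → 1 ≤ k → (g : Bits k → Bits k → Bool) → Regular g →
    ∀ (n : ℕ) → 1 ≤ n →
    ColBits n ⊚ g ≤ᴿ BiCol ((2 ^ n) ^ (2 * k)) (k * n) ([2^n]^2k≡2^[kn+kn] n k)
theorem8 k 1≤k g regular n _ =
  rerandomise (regular⇒rerandomisation 1≤k g regular) n ([2^n]^2k≡2^[kn+kn] n k)
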